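{- Let $n\geq 2$ be an integer and let $k>2$ be an even integer. Then $P_k^{r,r+1}(n-1)$ is Eulerian for every $r\in\mathbb{Z}$ satisfying $n\leq r<(k-1)n$.
   Context: A $k$-ary $n$-tuple is an element of $\mathbb{Z}_k^n$, with entries identified with the integers $0,1,\dots,k-1$. The de Bruijn digraph $B_k(n-1)$ has vertex set $\mathbb{Z}_k^{n-1}$, and its edges are identified with the $k$-ary $n$-tuples: the $n$-tuple $(x_0,\dots,x_{n-1})$ is the edge from vertex $(x_0,\dots,x_{n-2})$ to vertex $(x_1,\dots,x_{n-1})$ (loops allowed). A subgraph "consisting of" a set of edges has exactly those edges, and its vertices are the vertices incident with at least one of them. A digraph is Eulerian if it is strongly connected (there is a directed path between any ordered pair of its vertices) and balanced (every vertex has in-degree equal to out-degree). Define $f:\mathbb{Z}_k\to\mathbb{Q}$ by $f(a)=a$ (as an integer in $[0,k-1]$) if $a\neq 0$, and $f(0)=k/2$. The pseudoweight of a $k$-ary $n$-tuple $\mathbf{a}=(a_0,\dots,a_{n-1})$ is $w_p(\mathbf{a})=\sum_{i=0}^{n-1}f(a_i)$, computed in $\mathbb{Q}$. For $0\leq r\leq s\leq (k-1)n$, $P_k^{r,s}(n-1)$ is the subgraph of $B_k(n-1)$ consisting of the edges corresponding to $n$-tuples $\mathbf{a}$ with $r\leq w_p(\mathbf{a})\leq s$. -}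

module Defs where

open import Data.Fin.Base using (Fin; zero; suc; toℕ)
import Data.Fin.Properties as Fin
open import Data.Integer.Base using (ℤ; +_)
open import Data.List.Base using (List; []; _∷_; allFin; cartesianProductWith; filter; length)
open import Data.List.Membership.Propositional using (_∈_)
open import Data.List.Membership.Propositional.Properties using (∈-allFin; ∈-cartesianProductWith⁺)
open import Data.List.Relation.Unary.All using ([])
open import Data.List.Relation.Unary.AllPairs using ([]; _∷_)
open import Data.List.Relation.Unary.Any using (here)
open import Data.List.Relation.Unary.Unique.Propositional using (Unique)
open import Data.List.Relation.Unary.Unique.Propositional.Properties using (allFin⁺; cartesianProductWith⁺)
open import Data.Nat.Base using (ℕ; zero; suc)
open import Data.Product.Base using (_×_; _,_; ∃-syntax)
open import Data.Rational.Base using (ℚ; 0ℚ; _/_; _+_; _≤_)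
import Data.Rational.Properties as ℚ
open import Data.Sum.Base using (_⊎_; inj₁; inj₂)
open import Data.Vec.Base as Vec using (Vec; []; _∷_; init; tail)
open import Data.Vec.Properties using (≡-dec; ∷-injective)
open import Level using (0ℓ)
open import Relation.Binary.Construct.Closure.ReflexiveTransitive using (Star)
open import Relation.Binary.Core using (Rel)
open import Relation.Binary.Definitions using (DecidableEquality)
open import Relation.Binary.PropositionalEquality using (_≡_; refl)
open import Relation.Nullary.Decidable using (_×-dec_)
open import Relation.Unary using (Pred; Decidable)

-- Digraphs with finitely many edges; loops are allowed. The enumeration of
-- the edges is there only so that degrees can be computed as natural numbers.

record Digraph : Set₁ where
  field
    Vertex         : Set
    Edge           : Set
    source target  : Edge → Vertex
    _≟_            : DecidableEquality Vertex
    edges          : List Edge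
    edges-complete : ∀ e → e ∈ edges
    edges-unique   : Unique edges

record Subgraph (G : Digraph) : Set₁ where
  open Digraph G
  field
    IsVertex  : Pred Vertex 0ℓ
    IsEdge    : Pred Edge 0ℓ
    isEdge?   : Decidable IsEdge
    source-in : ∀ {e} → IsEdge e → IsVertex (source e)
    target-in : ∀ {e} → IsEdge e → IsVertex (target e)

module _ {G : Digraph} (H : Subgraph G) where
  open Digraph G
  open Subgraph H

  Adjacent : Rel Vertex 0ℓ
  Adjacent u v = ∃[ e ] IsEdge e × source e ≡ u × target e ≡ v

  -- Star Adjacent u v: a directed path from u to v, possibly of length 0,
  -- all of whose edges lie in H.
  StronglyConnected : Set
  StronglyConnected = ∀ {u v} → IsVertex u → IsVertex v → Star Adjacent u v

  inDegree outDegree : Vertex → ℕ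
  inDegree  v = length (filter (λ e → isEdge? e ×-dec (target e ≟ v)) edges)
  outDegree v = length (filter (λ e → isEdge? e ×-dec (source e ≟ v)) edges)

  Balanced : Set
  Balanced = ∀ {v} → IsVertex v → inDegree v ≡ outDegree v

  Eulerian : Set
  Eulerian = StronglyConnected × Balanced

consistingOf : (G : Digraph) (S : Pred (Digraph.Edge G) 0ℓ) → Decidable S → Subgraph G
consistingOf G S S? = record
  { IsVertex  = λ v → ∃[ e ] S e × (source e ≡ v ⊎ target e ≡ v)
  ; IsEdge    = S
  ; isEdge?   = S?
  ; source-in = λ {e} p → e , p , inj₁ refl
  ; target-in = λ {e} p → e , p , inj₂ refl
  }
  where open Digraph G

-- k-ary n-tuples; the element a of ℤₖ is represented by its residue in Fin k.

Tuple : ℕ → ℕ → Set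
Tuple k n = Vec (Fin k) n

tuples : ∀ k n → List (Tuple k n)
tuples k zero    = [] ∷ []
tuples k (suc n) = cartesianProductWith _∷_ (allFin k) (tuples k n)

tuples-complete : ∀ {k n} (a : Tuple k n) → a ∈ tuples k n
tuples-complete []      = here refl
tuples-complete (x ∷ a) = ∈-cartesianProductWith⁺ _∷_ (∈-allFin x) (tuples-complete a)

tuples-unique : ∀ k n → Unique (tuples k n)
tuples-unique k zero    = [] ∷ []
tuples-unique k (suc n) =
  cartesianProductWith⁺ _∷_ ∷-injective (allFin⁺ k) (tuples-unique k n)

-- deBruijn k m is Bₖ(m): its vertices are the m-tuples and its edges the
-- (m + 1)-tuples.

deBruijn : ℕ → ℕ → Digraph
deBruijn k m = record
  { Vertex         = Tuple k m
  ; Edge           = Tuple k (suc m)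
  ; source         = init
  ; target         = tail
  ; _≟_            = ≡-dec Fin._≟_
  ; edges          = tuples k (suc m)
  ; edges-complete = tuples-complete
  ; edges-unique   = tuples-unique k (suc m)
  }

f : ∀ {k} → Fin k → ℚ
f {k} zero    = + k / 2
f {k} (suc a) = + toℕ (suc a) / 1

pseudoweight : ∀ {k n} → Tuple k n → ℚ
pseudoweight a = Vec.foldr′ _+_ 0ℚ (Vec.map f a)

-- P k m r s is the subgraph Pₖ^{r,s}(m) of Bₖ(m). It is usually considered
-- only for 0 ≤ r ≤ s ≤ (k - 1)(m + 1), but the definition makes sense for all
-- r and s.

P : (k m : ℕ) (r s : ℤ) → Subgraph (deBruijn k m)
P k m r s = consistingOf (deBruijn k m)
  (λ a → r / 1 ≤ pseudoweight a × pseudoweight a ≤ s / 1)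
  (λ a → (r / 1 ℚ.≤? pseudoweight a) ×-dec (pseudoweight a ℚ.≤? s / 1))

{-# OPTIONS --safe #-}
-- Let k = 2h, so that f takes exactly the integer values 1, …, k − 1 and
-- pseudoweights are integers. The pseudoweight is invariant under rotation of
-- tuples, and rotation maps the edges into a vertex bijectively to the edges out
-- of it, so the subgraph is balanced. Every edge moreover lies on the closed walk
-- formed by its rotations; consequently two edges that differ in a single entry
-- are joined by a walk: rotate until that entry is last, at which point both
-- edges leave the same vertex, and rotate on. It remains to join any two tuples
-- of weight r or r + 1 by single-entry changes that keep the weight in
-- {r, r + 1}. This is done entry by entry: to raise the first entry by one,
-- first lower a later entry by one if the weight is r + 1.
module Submission where

open import Defs
open import Data.Integer.Base using (ℤ; +_; 1ℤ; _+_; _≤_; _<_)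
open import Data.Nat.Base as ℕ using (ℕ; _∸_; _*_)
open import Data.Nat.Divisibility using (_∣_)

open import Data.Fin.Base using (Fin; zero; suc; toℕ; fromℕ<)
open import Data.Fin.Properties using (toℕ<n; toℕ-fromℕ<)
import Data.Integer.Base as ℤ
import Data.Integer.Properties as ℤ
open import Data.List.Base as List using (List)
import Data.List.Properties as List
open import Data.List.Membership.Propositional using (_∈_)
open import Data.List.Membership.Propositional.Properties using (∈-filter⁺; ∈-filter⁻; ∈-map⁺; ∈-map⁻)
open import Data.List.Membership.Propositional.Properties.WithK using (unique∧set⇒bag)
open import Data.List.Relation.Binary.BagAndSetEquality using (∼bag⇒↭)
open import Data.List.Relation.Binary.Permutation.Propositional.Properties using (↭-length)
open import Data.List.Relation.Unary.Unique.Propositional.Properties using (map⁺; filter⁺)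
open import Data.Nat.Base using (suc; z≤n; s≤s)
open import Data.Nat.Coprimality using (1-coprimeTo) renaming (sym to coprime-sym)
open import Data.Nat.Divisibility using (divides)
import Data.Nat.Properties as ℕ
open import Data.Product.Base using (_×_; _,_; ∃-syntax)
open import Data.Rational.Base as ℚ using (ℚ; mkℚ; _/_)
import Data.Rational.Properties as ℚ
import Data.Rational.Unnormalised.Base as ℚᵘ
open import Data.Sum.Base using (inj₁; inj₂)
open import Data.Vec.Base using (Vec; []; _∷_; _∷ʳ_; init; initLast; toList)
open import Data.Vec.Properties using (init-∷ʳ; toList-∷ʳ; toList-injective; cast-is-id; ∷ʳ-injective)
open import Function.Base using (_∘_)
open import Function.Bundles using (mk⇔)
open import Level using (0ℓ)
open import Relation.Binary.Construct.Closure.ReflexiveTransitive as Star using (Star; ε; _◅_; _◅◅_)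
open import Relation.Binary.PropositionalEquality using (_≡_; refl; sym; trans; cong; cong₂; subst; subst₂; module ≡-Reasoning)
open import Relation.Unary using (Pred; Decidable)

-- Single-entry changes and rotations of tuples.

data Change {A : Set} : ∀ {n} → Vec A n → Vec A n → Set where
  here  : ∀ {n x y} {v : Vec A n} → Change (x ∷ v) (y ∷ v)
  there : ∀ {n x} {v w : Vec A n} → Change v w → Change (x ∷ v) (x ∷ w)

module _ {A : Set} where

  Change-sym : ∀ {n} {v w : Vec A n} → Change v w → Change w v
  Change-sym here      = here
  Change-sym (there c) = there (Change-sym c)

  -- Over lists, the passage from `p ++ q` to its rotation `q ++ p` needs no arithmetic on lengths.
  Change-toList : ∀ {n} {v w : Vec A n} → Change v w → ∃[ p ] ∃[ x ] ∃[ y ] ∃[ q ]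
    toList v ≡ p List.++ x List.∷ q × toList w ≡ p List.++ y List.∷ q
  Change-toList here = List.[] , _ , _ , _ , refl , refl
  Change-toList (there c) with Change-toList c
  ... | p , x , y , q , eq , eq′ =
    _ List.∷ p , x , y , q , cong (_ List.∷_) eq , cong (_ List.∷_) eq′

  toList-inj : ∀ {n} (v w : Vec A n) → toList v ≡ toList w → v ≡ w
  toList-inj v w eq = trans (sym (cast-is-id refl v)) (toList-injective refl v w eq)

  init-cong : ∀ {n} (v w : Vec A (suc n)) {l x y} →
    toList v ≡ l List.∷ʳ x → toList w ≡ l List.∷ʳ y → init v ≡ init w
  init-cong v w v≡ w≡ with initLast v | initLast w
  ... | v′ , x , refl | w′ , y , refl = toList-inj v′ w′
    (trans (List.∷ʳ-injectiveˡ _ _ (trans (sym (toList-∷ʳ x v′)) v≡))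
      (sym (List.∷ʳ-injectiveˡ _ _ (trans (sym (toList-∷ʳ y w′)) w≡))))

  rotate : ∀ {n} → Vec A (suc n) → Vec A (suc n)
  rotate (x ∷ v) = v ∷ʳ x

  rotate-injective : ∀ {n} {v w : Vec A (suc n)} → rotate v ≡ rotate w → v ≡ w
  rotate-injective {v = x ∷ v} {y ∷ w} eq with ∷ʳ-injective v w eq
  ... | refl , refl = refl

  rotate-surjective : ∀ {n} (v : Vec A (suc n)) → ∃[ w ] rotate w ≡ v
  rotate-surjective v with initLast v
  ... | w , x , eq = x ∷ w , sym eq

-- Rotation-invariant edge sets: balance and strong connectivity.

module RotationInvariant {k m : ℕ} (S : Pred (Tuple k (suc m)) 0ℓ) (S? : Decidable S)
  (S-rotate : ∀ a → S a → S (rotate a)) (S-unrotate : ∀ a → S (rotate a) → S a) where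

  G = deBruijn k m
  H = consistingOf G S S?
  open Digraph G using (source; target; edges; edges-complete; edges-unique)

  source-rotate : ∀ a → source (rotate a) ≡ target a
  source-rotate (x ∷ v) = init-∷ʳ x v

  balanced : Balanced H
  balanced {v} _ = begin
    inDegree H v                      ≡⟨ List.length-map rotate ins ⟨
    -- Both lists are free of repetitions, so having the same members makes them permutations of
    -- each other.
    List.length (List.map rotate ins) ≡⟨ ↭-length (∼bag⇒↭ (unique∧set⇒bag
      (map⁺ rotate-injective (filter⁺ _ edges-unique)) (filter⁺ _ edges-unique)
      (mk⇔ to from))) ⟩
    outDegree H v                     ∎
    where
    open ≡-Reasoning
    ins outs : List (Tuple k (suc m))
    ins  = List.filter _ edges
    outs = List.filter _ edges
    to : ∀ {b} → b ∈ List.map rotate ins → b ∈ outs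
    to b∈ with ∈-map⁻ rotate b∈
    ... | a , a∈ , refl with ∈-filter⁻ _ {xs = edges} a∈
    ... | _ , Sa , refl =
      ∈-filter⁺ _ (edges-complete _) (S-rotate a Sa , source-rotate a)
    from : ∀ {b} → b ∈ outs → b ∈ List.map rotate ins
    from {b} b∈ with rotate-surjective b | ∈-filter⁻ _ {xs = edges} b∈
    ... | a , refl | _ , Sb , refl =
      ∈-map⁺ rotate (∈-filter⁺ _ (edges-complete a) (S-unrotate a Sb , sym (source-rotate a)))

  -- Induction on `p`: each rotation moves one entry of `p` to the end, and the edge `a` itself is
  -- the step from its source to that of `rotate a`.
  rotation-walk : ∀ p q a → S a → toList a ≡ p List.++ q →
    ∃[ b ] S b × toList b ≡ q List.++ p × Star (Adjacent H) (source a) (source b)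
  rotation-walk List.[] q a Sa eq = a , Sa , trans eq (sym (List.++-identityʳ q)) , ε
  rotation-walk (x List.∷ p) q a@(y ∷ v) Sa eq with List.∷-injective eq
  ... | refl , v≡ with rotation-walk p (q List.∷ʳ x) (rotate a) (S-rotate a Sa)
    (trans (toList-∷ʳ x v) (trans (cong (List._∷ʳ x) v≡) (List.++-assoc p q _)))
  ... | b , Sb , b≡ , walk =
    b , Sb , trans b≡ (List.∷ʳ-++ q x p) , (a , Sa , refl , sym (source-rotate a)) ◅ walk

  -- Write `a` as p x q and `b` as p y q. Their rotations q p x and q p y have the same source; the
  -- walk reaches it along rotations of `a` and leaves it along rotations of `b`.
  change-walk : ∀ {a b} → S a → S b → Change a b → Star (Adjacent H) (source a) (source b)
  change-walk {a} {b} Sa Sb c with Change-toList c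
  ... | p , x , y , q , a≡ , b≡
    with rotation-walk (p List.∷ʳ x) q a Sa (trans a≡ (sym (List.∷ʳ-++ p x q)))
       | rotation-walk (p List.∷ʳ y) q b Sb (trans b≡ (sym (List.∷ʳ-++ p y q)))
  ... | a′ , _ , a′≡ , walk | b′ , Sb′ , b′≡ , _
    -- Moving `q` to the end as well brings `b′` full circle to `b`.
    with rotation-walk q (p List.∷ʳ y) b′ Sb′ b′≡
  ... | b″ , _ , b″≡ , walk′
    with toList-inj b″ b (trans b″≡ (trans (List.∷ʳ-++ p y q) (sym b≡)))
  ... | refl = walk ◅◅ subst (λ u → Star (Adjacent H) u (source b)) source-b′≡source-a′ walk′
    where
    source-b′≡source-a′ : source b′ ≡ source a′
    source-b′≡source-a′ = init-cong b′ a′ (trans b′≡ (sym (List.++-assoc q p _)))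
                            (trans a′≡ (sym (List.++-assoc q p _)))

  -- The target of an edge is the source of its rotation, so it suffices to connect sources.
  vertex-source : ∀ {v} → Subgraph.IsVertex H v → ∃[ a ] S a × source a ≡ v
  vertex-source (a , Sa , inj₁ eq) = a , Sa , eq
  vertex-source (a , Sa , inj₂ eq) = rotate a , S-rotate a Sa , trans (source-rotate a) eq

  eulerian : (∀ {a b} → S a → S b → Star (λ a b → S a × S b × Change a b) a b) → Eulerian H
  eulerian joined = stronglyConnected , balanced
    where
    stronglyConnected : StronglyConnected H
    stronglyConnected u∈ v∈ with vertex-source u∈ | vertex-source v∈
    ... | a , Sa , refl | b , Sb , refl =
      Star.kleisliStar source (λ (Sa , Sb , c) → change-walk Sa Sb c) (joined Sa Sb)

-- Joining vectors by single-entry changes within two consecutive weights.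

module Weight {A : Set} (g : A → ℕ) where

  weight : ∀ {n} → Vec A n → ℕ
  weight []      = 0
  weight (x ∷ v) = g x ℕ.+ weight v

  weight-∷ʳ : ∀ {n} (v : Vec A n) x → weight (v ∷ʳ x) ≡ weight (x ∷ v)
  weight-∷ʳ []      x = refl
  weight-∷ʳ (y ∷ v) x = begin
    g y ℕ.+ weight (v ∷ʳ x)      ≡⟨ cong (g y ℕ.+_) (weight-∷ʳ v x) ⟩
    g y ℕ.+ (g x ℕ.+ weight v)   ≡⟨ ℕ.+-assoc (g y) (g x) _ ⟨
    (g y ℕ.+ g x) ℕ.+ weight v   ≡⟨ cong (ℕ._+ weight v) (ℕ.+-comm (g y) (g x)) ⟩
    (g x ℕ.+ g y) ℕ.+ weight v   ≡⟨ ℕ.+-assoc (g x) (g y) _ ⟩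
    g x ℕ.+ (g y ℕ.+ weight v)   ∎
    where open ≡-Reasoning

  weight-rotate : ∀ {n} (v : Vec A (suc n)) → weight (rotate v) ≡ weight v
  weight-rotate (x ∷ v) = weight-∷ʳ v x

  module _ (intermediate : ∀ {x y t} → g x ℕ.≤ t → t ℕ.≤ g y → ∃[ z ] g z ≡ t) where

    -- The lighter `w` certifies that `v` can be lowered: it has a smaller entry somewhere, and
    -- there `intermediate` supplies the value one below that of `v`.
    decrement : ∀ {n} (v w : Vec A n) → weight w ℕ.< weight v →
      ∃[ v′ ] Change v v′ × suc (weight v′) ≡ weight v
    decrement (x ∷ v) (y ∷ w) w<v with ℕ.<-≤-connex (g y) (g x)
    ... | inj₁ gy<gx with g x in gx≡
    ...   | suc t with intermediate {y} {x} (ℕ.s≤s⁻¹ gy<gx) (subst (t ℕ.≤_) (sym gx≡) (ℕ.n≤1+n t))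
    ...     | z , refl = z ∷ v , here , refl
    -- The head of `w` is at least as heavy here, so the tail of `w` must be lighter.
    decrement (x ∷ v) (y ∷ w) w<v | inj₂ gx≤gy
      with decrement v w (ℕ.+-cancelˡ-< (g x) _ _ (ℕ.≤-<-trans (ℕ.+-monoˡ-≤ (weight w) gx≤gy) w<v))
    ... | v′ , c , eq = x ∷ v′ , there c , trans (sym (ℕ.+-suc (g x) _)) (cong (g x ℕ.+_) eq)

    module _ (r : ℕ) where

      Window : Pred ℕ 0ℓ
      Window s = r ℕ.≤ s × s ℕ.≤ suc r

      -- c stands for the total weight of the entries already treated.
      InWindow : ℕ → ∀ {n} → Pred (Vec A n) 0ℓ
      InWindow c v = Window (c ℕ.+ weight v)

      Move : ℕ → ∀ {n} → Vec A n → Vec A n → Set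
      Move c v w = InWindow c v × InWindow c w × Change v w

      Move-sym : ∀ {c n} {v w : Vec A n} → Move c v w → Move c w v
      Move-sym (v∈ , w∈ , ch) = w∈ , v∈ , Change-sym ch

      Move-∷ : ∀ {c n} x {v w : Vec A n} → Move (c ℕ.+ g x) v w → Move c (x ∷ v) (x ∷ w)
      Move-∷ {c} x {v} {w} (v∈ , w∈ , ch) =
        subst Window (ℕ.+-assoc c (g x) _) v∈ ,
        subst Window (ℕ.+-assoc c (g x) _) w∈ , there ch

      -- If the total is `suc r`, then `v` outweighs `w`, since otherwise the heavier head `y` would
      -- push the total of `y ∷ w` beyond `suc r`. Hence `decrement` applies.
      lower-tail : ∀ {c n} x y (v w : Vec A n) → g x ℕ.< g y →
        InWindow c (x ∷ v) → InWindow c (y ∷ w) →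
        ∃[ v′ ] Star (Move c) (x ∷ v) (x ∷ v′) × c ℕ.+ weight (x ∷ v′) ≡ r
      lower-tail {c} x y v w gx<gy v∈@(r≤v , v≤1+r) (_ , w≤1+r) with ℕ.m≤n⇒m<n∨m≡n r≤v
      ... | inj₂ r≡v = v , ε , sym r≡v
      ... | inj₁ r<v with decrement v w (ℕ.≰⇒> λ v≤w → ℕ.<-irrefl refl (begin-strict
                suc r                        ≤⟨ r<v ⟩
                c ℕ.+ (g x ℕ.+ weight v)     <⟨ ℕ.+-monoʳ-< c (ℕ.+-mono-<-≤ gx<gy v≤w) ⟩
                c ℕ.+ (g y ℕ.+ weight w)     ≤⟨ w≤1+r ⟩
                suc r                        ∎))
        where open ℕ.≤-Reasoning
      ...   | v′ , ch , eq = v′ , (v∈ , v′∈ , there ch) ◅ ε , v′≡r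
        where
        open ≡-Reasoning
        v′≡r : c ℕ.+ (g x ℕ.+ weight v′) ≡ r
        v′≡r = ℕ.suc-injective (begin
          suc (c ℕ.+ (g x ℕ.+ weight v′))   ≡⟨ ℕ.+-suc c _ ⟨
          c ℕ.+ suc (g x ℕ.+ weight v′)     ≡⟨ cong (c ℕ.+_) (ℕ.+-suc (g x) _) ⟨
          c ℕ.+ (g x ℕ.+ suc (weight v′))   ≡⟨ cong (λ s → c ℕ.+ (g x ℕ.+ s)) eq ⟩
          c ℕ.+ (g x ℕ.+ weight v)          ≡⟨ ℕ.≤-antisym v≤1+r r<v ⟩
          suc r                             ∎)
        v′∈ : InWindow c (x ∷ v′)
        v′∈ = ℕ.≤-reflexive (sym v′≡r) , ℕ.≤-trans (ℕ.≤-reflexive v′≡r) (ℕ.n≤1+n r)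

      -- Induction on the gap `d`: once the total is down to `r`, raising the head by one gives
      -- `suc r`, still in the window. `w` stays fixed, as the witness that the tail can be lowered
      -- again.
      raise-head : ∀ d {c n} x y (v w : Vec A n) → g x ℕ.+ d ≡ g y →
        InWindow c (x ∷ v) → InWindow c (y ∷ w) →
        ∃[ v′ ] InWindow c (y ∷ v′) × Star (Move c) (x ∷ v) (y ∷ v′)
      -- Heads of equal value may be different letters, as 0 and k/2 are for `f`, so a
      -- weight-preserving change is made.
      raise-head 0 {c} x y v w gx≡gy v∈ w∈ = v , v′∈ , (v∈ , v′∈ , here) ◅ ε
        where
        v′∈ : InWindow c (y ∷ v)
        v′∈ = subst Window
          (cong (λ s → c ℕ.+ (s ℕ.+ weight v)) (trans (sym (ℕ.+-identityʳ (g x))) gx≡gy)) v∈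
      raise-head (suc d) {c} x y v w gx+d≡gy v∈ w∈
        with lower-tail x y v w gx<gy v∈ w∈ | intermediate {x} {y} (ℕ.n≤1+n _) gx<gy
        where
        gx<gy : g x ℕ.< g y
        gx<gy = subst (g x ℕ.<_) gx+d≡gy (ℕ.m<m+n (g x) ℕ.z<s)
      ... | v₁ , moves , v₁≡r | z , gz≡ =
        let v′ , v′∈ , moves′ = raise-head d z y v₁ w gz+d≡gy v₂∈ w∈
        in v′ , v′∈ , moves ◅◅ (v₁∈ , v₂∈ , here) ◅ moves′
        where
        open ≡-Reasoning
        gz+d≡gy : g z ℕ.+ d ≡ g y
        gz+d≡gy = trans (cong (ℕ._+ d) gz≡) (trans (sym (ℕ.+-suc (g x) d)) gx+d≡gy)
        v₂≡1+r : c ℕ.+ (g z ℕ.+ weight v₁) ≡ suc r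
        v₂≡1+r = begin
          c ℕ.+ (g z ℕ.+ weight v₁)       ≡⟨ cong (λ s → c ℕ.+ (s ℕ.+ weight v₁)) gz≡ ⟩
          c ℕ.+ suc (g x ℕ.+ weight v₁)   ≡⟨ ℕ.+-suc c _ ⟩
          suc (c ℕ.+ (g x ℕ.+ weight v₁)) ≡⟨ cong suc v₁≡r ⟩
          suc r                           ∎
        v₁∈ : InWindow c (x ∷ v₁)
        v₁∈ = ℕ.≤-reflexive (sym v₁≡r) , ℕ.≤-trans (ℕ.≤-reflexive v₁≡r) (ℕ.n≤1+n r)
        v₂∈ : InWindow c (z ∷ v₁)
        v₂∈ = ℕ.≤-trans (ℕ.n≤1+n r) (ℕ.≤-reflexive (sym v₂≡1+r)) , ℕ.≤-reflexive v₂≡1+r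

      joined : ∀ c {n} (v w : Vec A n) → InWindow c v → InWindow c w → Star (Move c) v w
      joined-∷ : ∀ c {n} x y (v w : Vec A n) → g x ℕ.≤ g y →
        InWindow c (x ∷ v) → InWindow c (y ∷ w) → Star (Move c) (x ∷ v) (y ∷ w)

      joined c []      []      _  _  = ε
      joined c (x ∷ v) (y ∷ w) v∈ w∈ with ℕ.≤-total (g x) (g y)
      ... | inj₁ gx≤gy = joined-∷ c x y v w gx≤gy v∈ w∈
      -- Moves are reversible, so heads that would have to be lowered need no separate treatment.
      ... | inj₂ gy≤gx = Star.reverse Move-sym (joined-∷ c y x w v gy≤gx w∈ v∈)

      joined-∷ c x y v w gx≤gy v∈ w∈
        with raise-head (g y ∸ g x) x y v w (ℕ.m+[n∸m]≡n gx≤gy) v∈ w∈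
      -- The heads now agree; their weight is absorbed into `c` and the tails are joined
      -- recursively.
      ... | v′ , v′∈ , moves = moves ◅◅ Star.gmap (y ∷_) (Move-∷ y) (joined (c ℕ.+ g y) v′ w
        (subst Window (sym (ℕ.+-assoc c (g y) _)) v′∈)
        (subst Window (sym (ℕ.+-assoc c (g y) _)) w∈))

-- Pseudoweights as natural-number weights, and the transfer to `P`.

value : ℕ → ∀ {k} → Fin k → ℕ
value h zero    = h
value h (suc a) = suc (toℕ a)

value>0 : ∀ {h k} → 0 ℕ.< h → (a : Fin k) → 0 ℕ.< value h a
value>0 h>0 zero    = h>0
value>0 h>0 (suc a) = ℕ.z<s

value<k : ∀ {h k} → h ℕ.< k → (a : Fin k) → value h a ℕ.< k
value<k h<k zero    = h<k
value<k h<k (suc a) = s≤s (toℕ<n a)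

value-surjective : ∀ {h k t} → 0 ℕ.< t → t ℕ.< k → ∃[ a ] value h {k} a ≡ t
value-surjective {t = suc t} _ (s≤s t<k) = suc (fromℕ< t<k) , cong suc (toℕ-fromℕ< t<k)

-- All values lie strictly between 0 and `k`, and each number there is the value of a nonzero
-- letter, so the range has no gaps.
value-intermediate : ∀ {h k} → 0 ℕ.< h → h ℕ.< k → {a b : Fin k} {t : ℕ} →
  value h a ℕ.≤ t → t ℕ.≤ value h b → ∃[ c ] value h {k} c ≡ t
value-intermediate h>0 h<k {a} {b} a≤t t≤b =
  value-surjective (ℕ.<-≤-trans (value>0 h>0 a) a≤t) (ℕ.≤-<-trans t≤b (value<k h<k b))

n/1≡mkℚ : ∀ n → + n / 1 ≡ mkℚ (+ n) 0 (coprime-sym (1-coprimeTo n))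
n/1≡mkℚ n = ℚ.normalize-coprime (coprime-sym (1-coprimeTo n))

/1-homo-+ : ∀ m n → + m / 1 ℚ.+ + n / 1 ≡ + (m ℕ.+ n) / 1
/1-homo-+ m n = begin
  + m / 1 ℚ.+ + n / 1               ≡⟨ cong₂ ℚ._+_ (n/1≡mkℚ m) (n/1≡mkℚ n) ⟩
  -- In normal form both denominators are 1, so the sum unfolds to this fraction.
  (+ m ℤ.* 1ℤ + + n ℤ.* 1ℤ) / 1
    ≡⟨ cong (_/ 1) (cong₂ _+_ (ℤ.*-identityʳ (+ m)) (ℤ.*-identityʳ (+ n))) ⟩
  + (m ℕ.+ n) / 1                   ∎
  where open ≡-Reasoning

/1-mono-≤ : ∀ {m n} → m ℕ.≤ n → + m / 1 ℚ.≤ + n / 1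
/1-mono-≤ {m} {n} m≤n = subst₂ ℚ._≤_ (sym (n/1≡mkℚ m)) (sym (n/1≡mkℚ n))
  (ℚ.*≤* (ℤ.*-monoʳ-≤-nonNeg 1ℤ (_≤_.+≤+ m≤n)))

/1-cancel-≤ : ∀ {m n} → + m / 1 ℚ.≤ + n / 1 → m ℕ.≤ n
/1-cancel-≤ {m} {n} m≤n with subst₂ ℚ._≤_ (n/1≡mkℚ m) (n/1≡mkℚ n) m≤n
... | ℚ.*≤* p = ℤ.drop‿+≤+ (ℤ.*-cancelʳ-≤-pos (+ m) (+ n) 1ℤ p)

f≡value : ∀ {h k} → k ≡ h * 2 → (a : Fin k) → f a ≡ + value h a / 1
-- Cross-multiplication turns k/2 = h/1 into k * 1 = h * 2; `mkℚᵘ` stores the denominator minus one.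
f≡value {h} {k} k≡2h zero = ℚ.fromℚᵘ-cong {ℚᵘ.mkℚᵘ (+ k) 1} {ℚᵘ.mkℚᵘ (+ h) 0}
  (ℚᵘ.*≡* (trans (ℤ.*-identityʳ (+ k)) (trans (cong +_ k≡2h) (ℤ.pos-* h 2))))
f≡value k≡2h (suc a) = refl

module _ {h k : ℕ} (k≡2h : k ≡ h * 2) where
  open Weight (value h {k})

  pseudoweight≡weight : ∀ {n} (a : Tuple k n) → pseudoweight a ≡ + weight a / 1
  pseudoweight≡weight []      = refl
  pseudoweight≡weight (x ∷ a) =
    trans (cong₂ ℚ._+_ (f≡value {h} k≡2h x) (pseudoweight≡weight a))
      (/1-homo-+ (value h x) (weight a))

  P-eulerian : 0 ℕ.< h → h ℕ.< k → ∀ m r → Eulerian (P k m (+ r) (+ suc r))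
  P-eulerian h>0 h<k m r = RotationInvariant.eulerian S
    (Subgraph.isEdge? (P k m (+ r) (+ suc r)))
    (λ a → subst Between (sym (rotate-pseudoweight a)))
    (λ a → subst Between (rotate-pseudoweight a))
    (λ {a} {b} Sa Sb → Star.map
      (λ {a} {b} (a∈ , b∈ , ch) →
        fromWindow a a∈ , fromWindow b b∈ , ch)
      (joined (value-intermediate h>0 h<k) r 0 a b (toWindow a Sa) (toWindow b Sb)))
    where
    Between : Pred ℚ 0ℓ
    Between q = + r / 1 ℚ.≤ q × q ℚ.≤ + suc r / 1

    S : Pred (Tuple k (suc m)) 0ℓ
    S = Between ∘ pseudoweight

    rotate-pseudoweight : ∀ a → pseudoweight {n = suc m} (rotate a) ≡ pseudoweight a
    rotate-pseudoweight a = trans (pseudoweight≡weight (rotate a))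
      (trans (cong (λ w → + w / 1) (weight-rotate a)) (sym (pseudoweight≡weight a)))

    toWindow : ∀ a → S a → r ℕ.≤ weight a × weight a ℕ.≤ suc r
    toWindow a Sa with subst Between (pseudoweight≡weight a) Sa
    ... | r≤w , w≤1+r = /1-cancel-≤ r≤w , /1-cancel-≤ w≤1+r

    fromWindow : ∀ a → r ℕ.≤ weight a × weight a ℕ.≤ suc r → S a
    fromWindow a (r≤w , w≤1+r) =
      subst Between (sym (pseudoweight≡weight a)) (/1-mono-≤ r≤w , /1-mono-≤ w≤1+r)

theorem5p6 : (n k : ℕ) → 2 ℕ.≤ n → 2 ℕ.< k → 2 ∣ k →
    (r : ℤ) → + n ≤ r → r < + ((k ∸ 1) * n) →
    Eulerian (P k (n ∸ 1) r (r + 1ℤ))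
-- The bound `+ n ≤ r` leaves only nonnegative `r`, for which `+ r + 1ℤ` computes to `+ (r + 1)`
-- rather than `+ suc r`.
theorem5p6 n k _ k>2 (divides (suc h) k≡2h) (+ r) _ _ =
  subst (λ s → Eulerian (P k (n ∸ 1) (+ r) (+ s))) (ℕ.+-comm 1 r)
    (P-eulerian k≡2h ℕ.z<s
      (subst (suc h ℕ.<_) (sym k≡2h) (ℕ.m<m*n (suc h) 2 (s≤s (s≤s z≤n)))) (n ∸ 1) r)
theorem5p6 n k _ () (divides 0 refl) r _ _
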